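{- Let $G$ be an infinite group. Then: (1) the family of all small subsets of $G$ and the family of all sparse subsets of $G$ are both $\nabla$-complete; (2) if $\mathcal{I}$ is a nonempty family of subsets of $G$ closed under finite unions and under taking subsets which is both $\Delta$-complete and $\nabla$-complete, then $\mathcal{I}=\mathcal{P}_G$ (in particular, no ideal of $\mathcal{P}_G$ is both $\Delta$-complete and $\nabla$-complete); (3) if $\mathcal{I}$ is a group ideal in $\mathcal{P}_G$, then $\mathcal{I}$ is $\Delta$-complete and every member of $\mathcal{I}$ is a small subset of $G$.
   Context: $\Delta(A)=\{g\in G: gA\cap A$ is infinite$\}$ and $\nabla(A)=\{B\subseteq G:\Delta(B)=A\}$. A family $\mathcal{F}$ of subsets of $G$ is $\Delta$-complete if $\Delta(A)\in\mathcal{F}$ for each $A\in\mathcal{F}$, and $\nabla$-complete if $\nabla(A)\subseteq\mathcal{F}$ for each $A\in\mathcal{F}$. An ideal in $\mathcal{P}_G$ is a family $\mathcal{I}$ of subsets with $G\notin\mathcal{I}$, closed under finite unions and subsets; it is a group ideal if it contains all finite subsets and $A,B\in\mathcal{I}$ imply $AB^{ -1}\in\mathcal{I}$. $A$ is large if $G=FA$ for some finite $F$; small if $L\setminus A$ is large for every large $L$. $A$ is sparse if for every infinite $X\subseteq G$ there is finite $F\subseteq X$ with $\bigcap_{g\in F}gA$ finite. -}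

module Defs where

open import Level using (Level; _⊔_; suc; Lift; lift)
open import Algebra.Bundles using (Group)
open import Data.List.Base using (List)
open import Data.Product.Base using (∃; _×_; _,_)
open import Data.Sum.Base using (_⊎_) renaming (map to ⊎-map)
open import Data.Unit.Base using (⊤; tt)
open import Relation.Nullary.Negation.Core using (¬_)
open import Relation.Unary as U using (Pred)
open import Relation.Binary.Definitions using (_Respects_)
import Data.List.Membership.Setoid as Membership

module SubsetsOf {c ℓ : Level} (G : Group c ℓ) where

  open Group G
  open Membership setoid using () renaming (_∈_ to _∈ᴸ_)

  infix 4 _∈_ _⊆_ _≐_

  -- Equality in G is the setoid equality _≈_, so a subset is a predicate
  -- that respects it.  The level c ⊔ ℓ is the least at which 𝒫 is closed under
  -- translates, products and Δ.
  record 𝒫 : Set (suc (c ⊔ ℓ)) where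
    constructor subset
    field
      mem  : Pred Carrier (c ⊔ ℓ)
      resp : mem Respects _≈_

  open 𝒫 public

  _∈_ : Carrier → 𝒫 → Set (c ⊔ ℓ)
  x ∈ A = mem A x

  _⊆_ : 𝒫 → 𝒫 → Set (c ⊔ ℓ)
  A ⊆ B = mem A U.⊆ mem B

  _≐_ : 𝒫 → 𝒫 → Set (c ⊔ ℓ)
  A ≐ B = mem A U.≐ mem B

  whole : 𝒫
  whole = subset (λ _ → Lift (c ⊔ ℓ) ⊤) (λ _ _ → lift tt)

  infixr 7 _∩_
  infixr 6 _∪_
  infixl 6 _∖_

  _∩_ : 𝒫 → 𝒫 → 𝒫
  A ∩ B = subset (λ x → x ∈ A × x ∈ B)
                 (λ x≈y (a , b) → resp A x≈y a , resp B x≈y b)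

  _∪_ : 𝒫 → 𝒫 → 𝒫
  A ∪ B = subset (λ x → x ∈ A ⊎ x ∈ B)
                 (λ x≈y → ⊎-map (resp A x≈y) (resp B x≈y))

  _∖_ : 𝒫 → 𝒫 → 𝒫
  A ∖ B = subset (λ x → x ∈ A × ¬ (x ∈ B))
                 (λ x≈y (a , ¬b) → resp A x≈y a , λ b → ¬b (resp B (sym x≈y) b))

  infixr 8 _·_ _⊙_

  _·_ : Carrier → 𝒫 → 𝒫
  g · A = subset (λ x → ∃ λ a → a ∈ A × x ≈ g ∙ a)
                 (λ x≈y (a , a∈A , x≈ga) → a , a∈A , trans (sym x≈y) x≈ga)

  _⊙_ : 𝒫 → 𝒫 → 𝒫
  A ⊙ B = subset (λ x → ∃ λ a → ∃ λ b → a ∈ A × b ∈ B × x ≈ a ∙ b)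
                 (λ x≈y (a , b , a∈A , b∈B , x≈ab) →
                   a , b , a∈A , b∈B , trans (sym x≈y) x≈ab)

  infix 9 _⁻¹ˢ

  _⁻¹ˢ : 𝒫 → 𝒫
  A ⁻¹ˢ = subset (λ x → ∃ λ a → a ∈ A × x ≈ a ⁻¹)
                 (λ x≈y (a , a∈A , x≈a⁻¹) → a , a∈A , trans (sym x≈y) x≈a⁻¹)

  ⋂-translates : 𝒫 → 𝒫 → 𝒫
  ⋂-translates F A = subset (λ x → ∀ g → g ∈ F → x ∈ g · A)
                            (λ x≈y h g g∈F → resp (g · A) x≈y (h g g∈F))

  Finite : 𝒫 → Set (c ⊔ ℓ)
  Finite A = ∃ λ (xs : List Carrier) → mem A U.≐ (_∈ᴸ xs)

  Infinite : 𝒫 → Set (c ⊔ ℓ)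
  Infinite A = ¬ Finite A

  private
    Finite-resp-≐ : ∀ {A B} → A ≐ B → Finite A → Finite B
    Finite-resp-≐ (A⊆B , B⊆A) (xs , A⊆xs , xs⊆A) =
      xs , (λ b → A⊆xs (B⊆A b)) , (λ x∈xs → A⊆B (xs⊆A x∈xs))

    ·-mono : ∀ {g h} A → g ≈ h → g · A ⊆ h · A
    ·-mono A g≈h (a , a∈A , x≈ga) = a , a∈A , trans x≈ga (∙-congʳ g≈h)

  Δ : 𝒫 → 𝒫
  Δ A = subset (λ g → Infinite (g · A ∩ A)) Δ-resp
    where
    Δ-resp : (λ g → Infinite (g · A ∩ A)) Respects _≈_
    Δ-resp g≈h inf fin = inf (Finite-resp-≐ {A = _ · A ∩ A} {B = _ · A ∩ A}
      ( (λ (p , q) → ·-mono A (sym g≈h) p , q)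
      , (λ (p , q) → ·-mono A g≈h p , q)) fin)

  Family : (i : Level) → Set (suc (c ⊔ ℓ ⊔ i))
  Family i = Pred 𝒫 i

  ∇ : 𝒫 → Family (c ⊔ ℓ)
  ∇ A B = Δ B ≐ A

  Δ-Complete : ∀ {i} → Family i → Set (suc (c ⊔ ℓ) ⊔ i)
  Δ-Complete 𝓕 = ∀ A → 𝓕 A → 𝓕 (Δ A)

  ∇-Complete : ∀ {i} → Family i → Set (suc (c ⊔ ℓ) ⊔ i)
  ∇-Complete 𝓕 = ∀ A → 𝓕 A → ∇ A U.⊆ 𝓕

  ClosedUnder∪ : ∀ {i} → Family i → Set (suc (c ⊔ ℓ) ⊔ i)
  ClosedUnder∪ 𝓘 = ∀ A B → 𝓘 A → 𝓘 B → 𝓘 (A ∪ B)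

  ClosedUnder⊆ : ∀ {i} → Family i → Set (suc (c ⊔ ℓ) ⊔ i)
  ClosedUnder⊆ 𝓘 = ∀ A B → A ⊆ B → 𝓘 B → 𝓘 A

  -- Closure under finite unions includes the empty union; given the other
  -- conditions, that amounts to the family being nonempty.
  record IsIdeal {i} (𝓘 : Family i) : Set (suc (c ⊔ ℓ) ⊔ i) where
    field
      nonempty : U.Satisfiable 𝓘
      proper   : ¬ 𝓘 whole
      ∪-closed : ClosedUnder∪ 𝓘
      ⊆-closed : ClosedUnder⊆ 𝓘

  record IsGroupIdeal {i} (𝓘 : Family i) : Set (suc (c ⊔ ℓ) ⊔ i) where
    field
      isIdeal    : IsIdeal 𝓘
      finite     : ∀ A → Finite A → 𝓘 A
      ⊙⁻¹-closed : ∀ A B → 𝓘 A → 𝓘 B → 𝓘 (A ⊙ B ⁻¹ˢ)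

  Large : Family (suc (c ⊔ ℓ))
  Large A = ∃ λ F → Finite F × whole ≐ F ⊙ A

  Small : Family (suc (c ⊔ ℓ))
  Small A = ∀ L → Large L → Large (L ∖ A)

  Sparse : Family (suc (c ⊔ ℓ))
  Sparse A = ∀ X → Infinite X →
             ∃ λ F → Finite F × F ⊆ X × Finite (⋂-translates F A)

{-# OPTIONS --safe #-}

-- (1) If Δ(B) is small and G = FL, choose g₀, …, gₙ with n = |F| such that
-- gᵢfB ∩ gⱼfB is finite for i < j and f ∈ F.  By the pigeonhole principle
-- ⋂ gᵢFB is finite, so finitely many translates of G ∖ FB ⊆ F(L ∖ B) cover G.
-- If Δ(B) is sparse, X infinite and F ⊆ X finite with ⋂ xΔ(B) finite (x ∈ F),
-- some y ∈ X avoids xΔ(B) for an x ∈ F, and {x, y} shows that B is sparse.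
--
-- (2) ∇-completeness puts into 𝓘 the finite sets, and then every Z with
-- Δ(Z) ⊆ {ε}.  A transfinite choice gives two such sets {x_j} and {γ_j x_j}
-- where γ takes each element of a given set D infinitely often; then
-- D ⊆ Δ({x_j} ∪ {γ_j x_j}) is in 𝓘.  For Δ(Z) ⊆ {ε} it is enough that no
-- member of Z is a product a b⁻¹ d of earlier ones.  Well-order G and take the
-- least initial segment U such that G is the union of the images D of U under
-- finitely many finitary operations.  If an x_j could not be chosen, such
-- products would exhibit G as such a union for a smaller initial segment.
--
-- (3) Δ(A) ⊆ AA⁻¹, and if B = FA and g ∉ BB⁻¹ then B and gB are disjoint, so
-- two translates of G ∖ FA ⊆ F(L ∖ A) cover G.
module Submission where

open import Defs
open import Level using (Level; Lift; lift; 0ℓ; _⊔_) renaming (suc to lsuc)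
open import Algebra.Bundles using (Group)
open import Axiom.ExcludedMiddle using (ExcludedMiddle)
open import Axiom.Extensionality.Propositional using (Extensionality; implicit-extensionality)
open import Data.Bool.Base using (Bool; true; false; T; _∨_)
open import Data.Bool.Properties using (T-∨)
open import Data.Empty using (⊥-elim)
open import Data.Fin.Base as Fin using (Fin)
open import Data.Fin.Properties using (pigeonhole)
open import Data.List.Base using (List; []; _∷_; _++_; map; filter; length; lookup; concatMap; cartesianProduct)
open import Data.List.Membership.Propositional using (find; lose) renaming (_∈_ to _∈≡_)
open import Data.List.Membership.Propositional.Properties using (∈-cartesianProduct⁺; ∈-lookup)
import Data.List.Membership.Setoid as Membership
import Data.List.Membership.Setoid.Properties as Membershipₚ
open import Data.List.Relation.Unary.All as All using (All; []; _∷_)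
open import Data.List.Relation.Unary.All.Properties using (¬All⇒Any¬)
open import Data.List.Relation.Unary.AllPairs.Core using (AllPairs; []; _∷_)
open import Data.List.Relation.Unary.Any as Any using (Any; here; there)
import Data.List.Relation.Unary.Any.Properties as Anyₚ
open import Data.Nat.Base as ℕ using (ℕ; zero; suc; s<s⁻¹)
import Data.Nat.Properties as ℕₚ
open import Data.Product.Base using (∃; _×_; _,_; proj₁; proj₂)
open import Data.Sum.Base using (_⊎_; inj₁; inj₂; [_,_]′)
open import Data.Unit.Base using (⊤; tt)
open import Data.Vec.Base as Vec using (Vec; []; _∷_)
import Data.Vec.Properties as Vecₚ
import Data.Vec.Relation.Binary.Lex.Strict as Lex
open import Data.Vec.Relation.Binary.Pointwise.Inductive using (Pointwise-≡⇒≡)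
open import Data.Vec.Relation.Unary.All as Allⱽ using ([]; _∷_) renaming (All to Allⱽ)
import Data.Vec.Relation.Unary.All.Properties as Allⱽₚ
open import Function.Base using (_∘_; id)
open import Function.Bundles using (Equivalence)
open import Induction.WellFounded as WF using (Acc; acc; WellFounded; WfRec; module FixPoint)
open import Relation.Binary.Core using (Rel)
open import Relation.Binary.Definitions using (Trichotomous; Transitive; Irreflexive; tri<; tri≈; tri>)
open import Relation.Binary.PropositionalEquality.Core as ≡ using (_≡_; cong; subst; resp₂)
open import Relation.Binary.PropositionalEquality.Properties using (isEquivalence)
open import Relation.Binary.Structures using (IsStrictTotalOrder)
open import Relation.Nullary.Decidable.Core using (Dec; yes; no; ⌊_⌋; toWitness; fromWitness)
open import Relation.Nullary.Negation.Core using (¬_; contradiction)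
open import Relation.Unary using (Pred; Satisfiable)

-- Excluded middle and Zermelo's well-ordering theorem.

module Classical (em : ∀ {a} → ExcludedMiddle a) where

  ¬¬-elim : ∀ {a} {P : Set a} → ¬ ¬ P → P
  ¬¬-elim {P = P} ¬¬p with em {P = P}
  ... | yes p = p
  ... | no ¬p = contradiction ¬p ¬¬p

module WellOrdering (em : ∀ {a} → ExcludedMiddle a)
                    (ext : ∀ {a b} → Extensionality a b)
                    {a : Level} (A : Set a) where

  open Classical em

  -- Boolean subsets, so that a union over any family of them is again one.
  private
    Sub : Set a
    Sub = A → Bool

    infix 4 _∈_ _⊆_
    _∈_ : A → Sub → Set
    x ∈ P = T (P x)

    _⊆_ : Sub → Sub → Set a
    P ⊆ Q = ∀ x → x ∈ P → x ∈ Q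

    T-ext : ∀ {b b′} → (T b → T b′) → (T b′ → T b) → b ≡ b′
    T-ext {false} {false} _ _ = ≡.refl
    T-ext {false} {true}  _ g = ⊥-elim (g _)
    T-ext {true}  {false} f _ = ⊥-elim (f _)
    T-ext {true}  {true}  _ _ = ≡.refl

    ⊆-antisym : ∀ {P Q} → P ⊆ Q → Q ⊆ P → P ≡ Q
    ⊆-antisym P⊆Q Q⊆P = ext λ x → T-ext (P⊆Q x) (Q⊆P x)

    ⋃ : (Sub → Bool) → Sub
    ⋃ S x = ⌊ em {P = ∃ λ P → T (S P) × x ∈ P} ⌋

    ∈⋃⁺ : ∀ S {P x} → T (S P) → x ∈ P → x ∈ ⋃ S
    ∈⋃⁺ S P∈S x∈P = fromWitness (_ , P∈S , x∈P)

    ∈⋃⁻ : ∀ S {x} → x ∈ ⋃ S → ∃ λ P → T (S P) × x ∈ P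
    ∈⋃⁻ S = toWitness

    -- The witness that `em` returns with a `yes` serves as the choice function on complements. The
    -- decision is a separate argument so that lemmas can match on it.
    extend : (P : Sub) → Dec (∃ λ a → ¬ a ∈ P) → Sub
    extend P (yes (a , _)) x = P x ∨ ⌊ em {P = x ≡ a} ⌋
    extend P (no _)        x = P x

    next : Sub → Sub
    next P = extend P em

    extend-⊇ : ∀ P d → P ⊆ extend P d
    extend-⊇ P (yes (a , _)) x x∈P = Equivalence.from (T-∨ {P x}) (inj₁ x∈P)
    extend-⊇ P (no _)        x x∈P = x∈P

    next-⊇ : ∀ P → P ⊆ next P
    next-⊇ P = extend-⊇ P em

    extend-full : ∀ P d → extend P d ⊆ P → ∀ x → x ∈ P
    extend-full P (yes (a , a∉P)) sub x =
      contradiction (sub a (Equivalence.from (T-∨ {P a}) (inj₂ (fromWitness ≡.refl)))) a∉P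
    extend-full P (no full)       sub x = ¬¬-elim λ x∉P → full (x , x∉P)

    extend-unique : ∀ P d {x y} → x ∈ extend P d → ¬ x ∈ P → y ∈ extend P d → ¬ y ∈ P → x ≡ y
    extend-unique P (yes (a , _)) {x} {y} x∈ x∉P y∈ y∉P = ≡.trans (new x x∈ x∉P) (≡.sym (new y y∈ y∉P))
      where
      new : ∀ z → T (P z ∨ ⌊ em {P = z ≡ a} ⌋) → ¬ z ∈ P → z ≡ a
      new z z∈ z∉P = [ (λ z∈P → contradiction z∈P z∉P) , toWitness ]′ (Equivalence.to (T-∨ {P z}) z∈)
    extend-unique P (no _) x∈ x∉P = contradiction x∈ x∉P

    -- Zermelo's argument: the tower is linearly ordered by inclusion, and an
    -- element is identified with the largest stage that misses it.
    data Tower : Sub → Set a where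
      step  : ∀ {P} → Tower P → Tower (next P)
      union : ∀ S → (∀ {P} → T (S P) → Tower P) → Tower (⋃ S)

    -- These are the extreme points of the Bourbaki-Witt argument: every stage is comparable with an
    -- extreme one, and by `pivot` every stage is extreme.
    Pivot : Sub → Set a
    Pivot Q = ∀ {P} → Tower P → P ⊆ Q → ¬ Q ⊆ P → next P ⊆ Q

    pivot-linear : ∀ {Q} → Pivot Q → ∀ {P} → Tower P → P ⊆ Q ⊎ next Q ⊆ P
    pivot-linear {Q} piv (step {P} tP) with pivot-linear piv tP
    ... | inj₂ Q⁺⊆P = inj₂ λ x → next-⊇ P x ∘ Q⁺⊆P x
    ... | inj₁ P⊆Q with em {P = Q ⊆ P}
    ...   | yes Q⊆P = inj₂ λ x → subst (λ R → x ∈ next R) (⊆-antisym Q⊆P P⊆Q)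
    ...   | no  Q⊈P = inj₁ (piv tP P⊆Q Q⊈P)
    pivot-linear {Q} piv (union S tS) with em {P = ∃ λ P → T (S P) × next Q ⊆ P}
    ... | yes (P , P∈S , Q⁺⊆P) = inj₂ λ x → ∈⋃⁺ S P∈S ∘ Q⁺⊆P x
    ... | no none = inj₁ λ x x∈⋃ → let P , P∈S , x∈P = ∈⋃⁻ S x∈⋃ in
          [ (λ P⊆Q → P⊆Q x x∈P) , (λ Q⁺⊆P → contradiction (P , P∈S , Q⁺⊆P) none) ]′
            (pivot-linear piv (tS P∈S))

    pivot : ∀ {Q} → Tower Q → Pivot Q
    pivot (step {Q} tQ) {P} tP P⊆Q⁺ Q⁺⊈P with pivot-linear (pivot tQ) tP
    ... | inj₂ Q⁺⊆P = contradiction Q⁺⊆P Q⁺⊈P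
    ... | inj₁ P⊆Q with em {P = Q ⊆ P}
    ...   | yes Q⊆P = λ x → subst (λ R → x ∈ next R) (⊆-antisym P⊆Q Q⊆P)
    ...   | no  Q⊈P = λ x → next-⊇ Q x ∘ pivot tQ tP P⊆Q Q⊈P x
    pivot (union S tS) {P} tP P⊆⋃ ⋃⊈P x x∈P⁺ = ∈⋃⁺ S Q∈S (pivot (tS Q∈S) tP P⊆Q Q⊈P x x∈P⁺)
      where
      -- Some member of the union is not inside `P`. By linearity it contains `P`, so the induction
      -- hypothesis for that member applies.
      member : ∃ λ Q → T (S Q) × ¬ Q ⊆ P
      member = ¬¬-elim λ none → ⋃⊈P λ x x∈⋃ → let Q , Q∈S , x∈Q = ∈⋃⁻ S x∈⋃ in
        ¬¬-elim λ x∉P → none (Q , Q∈S , λ Q⊆P → x∉P (Q⊆P x x∈Q))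
      Q   = proj₁ member
      Q∈S = proj₁ (proj₂ member)
      Q⊈P : ¬ Q ⊆ P
      Q⊈P = proj₂ (proj₂ member)
      P⊆Q : P ⊆ Q
      P⊆Q = [ id
            , (λ Q⁺⊆P → contradiction (λ x x∈Q → Q⁺⊆P x (next-⊇ Q x x∈Q)) Q⊈P) ]′
              (pivot-linear (pivot (tS Q∈S)) tP)

    linear : ∀ {P Q} → Tower P → Tower Q → P ⊆ Q ⊎ next Q ⊆ P
    linear tP tQ = pivot-linear (pivot tQ) tP

    avoiding : A → Sub → Bool
    avoiding a P = ⌊ em {P = Tower P × ¬ a ∈ P} ⌋

    rank : A → Sub
    rank a = ⋃ (avoiding a)

    rank-tower : ∀ a → Tower (rank a)
    rank-tower a = union (avoiding a) (proj₁ ∘ toWitness)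

    ∉rank : ∀ a → ¬ a ∈ rank a
    ∉rank a a∈ = let _ , P∈S , a∈P = ∈⋃⁻ (avoiding a) a∈ in proj₂ (toWitness P∈S) a∈P

    rank-max : ∀ {a P} → Tower P → ¬ a ∈ P → P ⊆ rank a
    rank-max {a} tP a∉P x = ∈⋃⁺ (avoiding a) (fromWitness (tP , a∉P))

    -- If the next stage still missed `a`, maximality would put it inside `rank a`. A stage that
    -- cannot grow is everything, yet `rank a` misses `a`.
    ∈next-rank : ∀ a → a ∈ next (rank a)
    ∈next-rank a = ¬¬-elim λ a∉ → ∉rank a
      (extend-full (rank a) em (rank-max (step (rank-tower a)) a∉) a)

    infix 4 _<_
    _<_ : Rel A 0ℓ
    a < b = a ∈ rank b

    <⇒⊆ : ∀ {a b} → a < b → rank a ⊆ rank b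
    <⇒⊆ {a} {b} a<b with linear (rank-tower a) (rank-tower b)
    ... | inj₁ ⊆ = ⊆
    ... | inj₂ ⊇ = contradiction (⊇ a (next-⊇ (rank b) a a<b)) (∉rank a)

    <-trans : Transitive _<_
    <-trans a<b b<c = <⇒⊆ b<c _ a<b

    <-irrefl : Irreflexive _≡_ _<_
    <-irrefl {a} ≡.refl = ∉rank a

    <-cmp : Trichotomous _≡_ _<_
    <-cmp a b with linear (rank-tower a) (rank-tower b) | linear (rank-tower b) (rank-tower a)
    ... | inj₂ b⁺⊆a | _ = tri> (λ a<b → <-irrefl ≡.refl (<-trans a<b b<a)) (λ a≡b → <-irrefl (≡.sym a≡b) b<a) b<a
      where
      b<a : b < a
      b<a = b⁺⊆a b (∈next-rank b)
    ... | inj₁ _ | inj₂ a⁺⊆b = tri< a<b (λ a≡b → <-irrefl a≡b a<b) (λ b<a → <-irrefl ≡.refl (<-trans a<b b<a))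
      where
      a<b : a < b
      a<b = a⁺⊆b a (∈next-rank a)
    ... | inj₁ a⊆b | inj₁ b⊆a = tri≈ (∉rank a ∘ b⊆a a) a≡b (∉rank b ∘ a⊆b b)
      where
      a≡b : a ≡ b
      -- The ranks are equal, and `a` and `b` are both the one element that the next stage adds.
      a≡b = extend-unique (rank b) em
        (subst (λ R → a ∈ next R) (⊆-antisym a⊆b b⊆a) (∈next-rank a))
        (∉rank a ∘ b⊆a a) (∈next-rank b) (∉rank b)

    -- Induction on the tower: an element that is new in `next P` has its rank, hence all its
    -- predecessors, inside `P`.
    tower-acc : ∀ {P} → Tower P → ∀ {x} → x ∈ P → Acc _<_ x
    tower-acc (union S tS) x∈ = let _ , P∈S , x∈P = ∈⋃⁻ S x∈ in tower-acc (tS P∈S) x∈P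
    tower-acc (step {P} tP) {x} x∈ with em {P = x ∈ P}
    ... | yes x∈P = tower-acc tP x∈P
    ... | no  x∉P with linear (rank-tower x) tP
    ...   | inj₁ x⊆P  = acc λ y<x → tower-acc tP (x⊆P _ y<x)
    ...   | inj₂ P⁺⊆x = contradiction (P⁺⊆x x x∈) (∉rank x)

  abstract
    wellOrder : ∃ λ (_<_ : Rel A 0ℓ) → IsStrictTotalOrder _≡_ _<_ × WellFounded _<_
    wellOrder = _<_ , isSTO , λ a → tower-acc (step (rank-tower a)) (∈next-rank a)
      where
      isSTO : IsStrictTotalOrder _≡_ _<_
      isSTO = record
        { isStrictPartialOrder = record
          { isEquivalence = isEquivalence
          ; irrefl        = <-irrefl
          ; trans         = <-trans
          ; <-resp-≈      = resp₂ _<_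
          }
        ; compare = <-cmp
        }

-- A pigeonhole principle for lists.

module _ {a p r} {A : Set a} {B : Set a} {R : Rel A r} {P : A → B → Set p} where

  private
    allPairs-lookup : ∀ {xs} → AllPairs R xs → ∀ {i j} → i Fin.< j → R (lookup xs i) (lookup xs j)
    allPairs-lookup (Rx ∷ _)  {Fin.zero}  {Fin.suc j} _   = All.lookup Rx (∈-lookup j)
    allPairs-lookup (_ ∷ Rxs) {Fin.suc i} {Fin.suc j} i<j = allPairs-lookup Rxs (s<s⁻¹ i<j)

  -- Pigeons are positions in `xs`, not values, so that `i < j` orients the colliding pair and
  -- `AllPairs` yields `R`.
  allPairs-pigeonhole : ∀ {xs ys} → AllPairs R xs → length ys ℕ.< length xs →
                        All (λ x → Any (P x) ys) xs →
                        ∃ λ x → ∃ λ x′ → ∃ λ y → (x ∈≡ xs × x′ ∈≡ xs × y ∈≡ ys) × R x x′ × P x y × P x′ y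
  allPairs-pigeonhole {xs} {ys} Rxs lt all =
    let i , j , i<j , eq = pigeonhole lt hole in
    lookup xs i , lookup xs j , lookup ys (hole i) ,
    (∈-lookup i , ∈-lookup j , ∈-lookup (hole i)) ,
    allPairs-lookup Rxs i<j , fits i , subst (P (lookup xs j) ∘ lookup ys) (≡.sym eq) (fits j)
    where
    choice : ∀ i → Any (P (lookup xs i)) ys
    choice i = All.lookup all (∈-lookup i)
    hole : Fin (length xs) → Fin (length ys)
    hole i = Any.index (choice i)
    fits : ∀ i → P (lookup xs i) (lookup ys (hole i))
    fits i = Anyₚ.lookup-index (choice i)

-- Finite, syndetic and meagre subsets of a group.

module Subsets (em : ∀ {a} → ExcludedMiddle a) {c ℓ} (G : Group c ℓ) where

  open Classical em public
  open Group G
  open import Algebra.Properties.Group G public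
  open import Relation.Binary.Reasoning.Setoid setoid
  open Membership setoid using () renaming (_∈_ to _∈ᴸ_)
  open SubsetsOf G

  [gh]⁻¹x : ∀ g h x → h ⁻¹ ∙ (g ⁻¹ ∙ x) ≈ (g ∙ h) ⁻¹ ∙ x
  [gh]⁻¹x g h x = begin
    h ⁻¹ ∙ (g ⁻¹ ∙ x)  ≈⟨ assoc _ _ _ ⟨
    h ⁻¹ ∙ g ⁻¹ ∙ x    ≈⟨ ∙-congʳ (⁻¹-anti-homo-∙ g h) ⟨
    (g ∙ h) ⁻¹ ∙ x     ∎

  ∈·⁺ : ∀ A {g x} → g ⁻¹ ∙ x ∈ A → x ∈ g · A
  ∈·⁺ A {g} {x} mem = g ⁻¹ ∙ x , mem , sym (\\-leftDividesˡ g x)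

  ∈·⁻ : ∀ A {g x} → x ∈ g · A → g ⁻¹ ∙ x ∈ A
  ∈·⁻ A {g} (a , a∈A , x≈ga) = resp A (sym (trans (∙-congˡ x≈ga) (\\-leftDividesʳ g a))) a∈A

  listed : List Carrier → 𝒫
  listed xs = subset (_∈ᴸ xs) (Membershipₚ.∈-resp-≈ setoid)

  ⋃ : ∀ {I : Set c} → List I → (I → 𝒫) → 𝒫
  ⋃ is A = subset (λ x → Any (λ i → x ∈ A i) is) (λ x≈y → Any.map (λ {i} → resp (A i) x≈y))

  subfinite⇒finite : ∀ A xs → A ⊆ listed xs → Finite A
  subfinite⇒finite A xs A⊆xs = filter (λ x → em {P = x ∈ A}) xs ,
    (λ x∈A → Membershipₚ.∈-filter⁺ setoid (λ x → em {P = x ∈ A}) (resp A) (A⊆xs x∈A) x∈A) ,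
    (λ x∈ → proj₂ (Membershipₚ.∈-filter⁻ setoid (λ x → em {P = x ∈ A}) (resp A) {xs = xs} x∈))

  finite-⊆ : ∀ A B → A ⊆ B → Finite B → Finite A
  finite-⊆ A B A⊆B (xs , B⊆xs , _) = subfinite⇒finite A xs (B⊆xs ∘ A⊆B)

  finite-listed : ∀ xs → Finite (listed xs)
  finite-listed xs = xs , id , id

  finite-∅ : ∀ A → (∀ {x} → ¬ x ∈ A) → Finite A
  finite-∅ A empty = [] , (λ x∈A → contradiction x∈A empty) , λ ()

  finite-∪ : ∀ A B → Finite A → Finite B → Finite (A ∪ B)
  finite-∪ A B (xs , A⊆xs , _) (ys , B⊆ys , _) = subfinite⇒finite (A ∪ B) (xs ++ ys)
    [ Anyₚ.++⁺ˡ ∘ A⊆xs , Anyₚ.++⁺ʳ xs ∘ B⊆ys ]′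

  finite-⋃ : ∀ {I : Set c} (is : List I) A → (∀ i → Finite (A i)) → Finite (⋃ is A)
  finite-⋃ []       A fin = finite-∅ (⋃ [] A) λ ()
  finite-⋃ (i ∷ is) A fin = finite-⊆ (⋃ (i ∷ is) A) (A i ∪ ⋃ is A) Any.toSum
    (finite-∪ (A i) (⋃ is A) (fin i) (finite-⋃ is A fin))

  finite-image : ∀ A B g → (∀ {x} → x ∈ A → g ⁻¹ ∙ x ∈ B) → Finite B → Finite A
  finite-image A B g into (ys , B⊆ys , _) = subfinite⇒finite A (map (g ∙_) ys) λ {x} x∈A →
    Membershipₚ.∈-resp-≈ setoid (\\-leftDividesˡ g x)
      (Membershipₚ.∈-map⁺ setoid setoid ∙-congˡ (B⊆ys (into x∈A)))

  infinite⇒satisfiable : ∀ A → Infinite A → ∃ λ x → x ∈ A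
  infinite⇒satisfiable A inf = ¬¬-elim λ none → inf (finite-∅ A λ {x} x∈A → none (x , x∈A))

  ∉Δ⇒finite : ∀ A {g} → ¬ g ∈ Δ A → Finite (g · A ∩ A)
  ∉Δ⇒finite A = ¬¬-elim

  -- This is `Large` with the finite set given as a list and `x ∈ g · A` written as `g ⁻¹ ∙ x ∈ A`.
  Syndetic : 𝒫 → Set (c ⊔ ℓ)
  Syndetic A = ∃ λ gs → ∀ x → Any (λ g → g ⁻¹ ∙ x ∈ A) gs

  large⇒syndetic : ∀ A → Large A → Syndetic A
  large⇒syndetic A (F , (gs , F⊆gs , _) , (cover , _)) = gs , λ x →
    let f , a , f∈F , a∈A , x≈fa = cover (lift _) in
    Any.map (λ {g} f≈g → ∈·⁻ A (a , a∈A , trans x≈fa (∙-congʳ f≈g))) (F⊆gs f∈F)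

  syndetic⇒large : ∀ A → Syndetic A → Large A
  syndetic⇒large A (gs , cover) = listed gs , finite-listed gs ,
    (λ {x} _ → let g , g∈gs , mem = find (cover x) in
      g , g ⁻¹ ∙ x , Any.map reflexive g∈gs , mem , sym (\\-leftDividesˡ g x)) ,
    λ _ → lift _

  syndetic-⊆ : ∀ A B → A ⊆ B → Syndetic A → Syndetic B
  syndetic-⊆ A B A⊆B (gs , cover) = gs , Any.map A⊆B ∘ cover

  syndetic-trans : ∀ A B hs → (∀ {x} → x ∈ A → Any (λ h → h ⁻¹ ∙ x ∈ B) hs) → Syndetic A → Syndetic B
  syndetic-trans A B hs sub (gs , cover) = concatMap (λ g → map (g ∙_) hs) gs , λ x →
    Anyₚ.concatMap⁺ (λ g → map (g ∙_) hs)
      (Any.map (λ {g} mem → Anyₚ.map⁺ (Any.map (λ {h} → resp B ([gh]⁻¹x g h x)) (sub mem))) (cover x))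

  syndetic-whole : Syndetic whole
  syndetic-whole = ε ∷ [] , λ _ → here (lift _)

  syndetic⇒satisfiable : ∀ A → Syndetic A → ∃ λ x → x ∈ A
  syndetic⇒satisfiable A (gs , cover) = let _ , mem = Any.satisfied (cover ε) in _ , mem

  -- The two-sided translate `a ⁻¹ A b ⁻¹`.
  pull : Carrier → Carrier → 𝒫 → 𝒫
  pull a b A = subset (λ x → a ∙ x ∙ b ∈ A) (λ x≈y → resp A (∙-congʳ (∙-congˡ x≈y)))

  -- The left factor is absorbed into the translators, which become `g ∙ a`; the right factor is
  -- handled by covering `x ∙ b` instead of `x`.
  syndetic-pull : ∀ a b A → Syndetic A → Syndetic (pull a b A)
  syndetic-pull a b A (gs , cover) = map (_∙ a) gs , λ x →
    Anyₚ.map⁺ (Any.map (λ {g} → resp A (begin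
      g ⁻¹ ∙ (x ∙ b)                  ≈⟨ assoc _ _ _ ⟨
      g ⁻¹ ∙ x ∙ b                    ≈⟨ ∙-congʳ (\\-leftDividesˡ a _) ⟨
      a ∙ (a ⁻¹ ∙ (g ⁻¹ ∙ x)) ∙ b     ≈⟨ ∙-congʳ (∙-congˡ ([gh]⁻¹x g a x)) ⟩
      a ∙ ((g ∙ a) ⁻¹ ∙ x) ∙ b        ∎)) (cover (x ∙ b)))

  -- Small, with largeness unfolded to the existence of a list of translators.
  Meagre : 𝒫 → Set _
  Meagre A = ∀ L → Syndetic L → Syndetic (L ∖ A)

  small⇒meagre : ∀ A → Small A → Meagre A
  small⇒meagre A small L syn = large⇒syndetic (L ∖ A) (small L (syndetic⇒large L syn))

  meagre⇒small : ∀ A → Meagre A → Small A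
  meagre⇒small A meagre L large = syndetic⇒large (L ∖ A) (meagre L (large⇒syndetic L large))

  meagre-pull : ∀ a b A → Meagre A → Meagre (pull a b A)
  meagre-pull a b A meagre L syn =
    syndetic-⊆ (pull a b (L′ ∖ A)) (L ∖ pull a b A)
      (λ {x} (l , x∉A) → resp L (cancel x) l , x∉A)
      (syndetic-pull a b (L′ ∖ A) (meagre L′ (syndetic-pull (a ⁻¹) (b ⁻¹) L syn)))
    where
    L′ : 𝒫
    L′ = pull (a ⁻¹) (b ⁻¹) L
    cancel : ∀ x → a ⁻¹ ∙ (a ∙ x ∙ b) ∙ b ⁻¹ ≈ x
    cancel x = begin
      a ⁻¹ ∙ (a ∙ x ∙ b) ∙ b ⁻¹    ≈⟨ ∙-congʳ (assoc _ _ _) ⟨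
      a ⁻¹ ∙ (a ∙ x) ∙ b ∙ b ⁻¹    ≈⟨ //-rightDividesʳ b _ ⟩
      a ⁻¹ ∙ (a ∙ x)               ≈⟨ \\-leftDividesʳ a x ⟩
      x                            ∎

  meagre-⋃ : ∀ {I : Set c} (is : List I) A → (∀ i → Meagre (A i)) → Meagre (⋃ is A)
  meagre-⋃ []       A meagre L syn = syndetic-⊆ L (L ∖ ⋃ [] A) (λ l → l , λ ()) syn
  meagre-⋃ (i ∷ is) A meagre L syn =
    syndetic-⊆ (L ∖ A i ∖ ⋃ is A) (L ∖ ⋃ (i ∷ is) A)
      (λ ((l , x∉Ai) , x∉⋃) → l , [ x∉Ai , x∉⋃ ]′ ∘ Any.toSum)
      (meagre-⋃ is A meagre (L ∖ A i) (meagre i L syn))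

  meagre⇒∃∉ : ∀ A → Meagre A → ∃ λ x → ¬ x ∈ A
  meagre⇒∃∉ A meagre = let x , _ , x∉A = syndetic⇒satisfiable (whole ∖ A) (meagre whole syndetic-whole) in x , x∉A

  -- As the group is infinite, a syndetic `L` is not contained in a finite `A`. One `l` in `L`
  -- outside `A` then reaches every `t` of `A`, since `t = (t ∙ l ⁻¹) ∙ l`.
  finite⇒meagre : Infinite whole → ∀ A → Finite A → Meagre A
  finite⇒meagre inf A finA@(ts , A⊆ts , _) L syn@(gs , cover) =
    syndetic-trans L (L ∖ A) (ε ∷ map (_∙ l ⁻¹) ts) move syn
    where
    outside : ∃ λ l → l ∈ L × ¬ l ∈ A
    outside = ¬¬-elim λ none →
      inf (finite-⊆ whole (⋃ gs (_· A))
        (λ {x} _ → Any.map (λ {g} mem → ∈·⁺ A (¬¬-elim λ ∉A → none (_ , mem , ∉A))) (cover x))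
        (finite-⋃ gs (_· A) λ g → finite-image (g · A) A g (∈·⁻ A) finA))
    l = proj₁ outside
    move : ∀ {x} → x ∈ L → Any (λ h → h ⁻¹ ∙ x ∈ (L ∖ A)) (ε ∷ map (_∙ l ⁻¹) ts)
    move {x} x∈L with em {P = x ∈ A}
    ... | no x∉A = here (resp (L ∖ A) (sym (trans (∙-congʳ ε⁻¹≈ε) (identityˡ x))) (x∈L , x∉A))
    ... | yes x∈A = there (Anyₚ.map⁺ (Any.map (λ {t} x≈t → resp (L ∖ A) (sym (begin
      (t ∙ l ⁻¹) ⁻¹ ∙ x       ≈⟨ [gh]⁻¹x t (l ⁻¹) x ⟨
      l ⁻¹ ⁻¹ ∙ (t ⁻¹ ∙ x)    ≈⟨ ∙-cong (⁻¹-involutive l) (∙-congˡ x≈t) ⟩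
      l ∙ (t ⁻¹ ∙ t)          ≈⟨ ∙-congˡ (inverseˡ t) ⟩
      l ∙ ε                   ≈⟨ identityʳ l ⟩
      l                       ∎)) (proj₂ outside)) (A⊆ts x∈A)))

  -- A point outside every `g · B` still lies in some `g · L`, hence in the translate by `g` of the
  -- difference. This closes both the argument from `Δ B` and the one for group ideals.
  cosyndetic-translates⇒syndetic-∖ : ∀ L B gs → (∀ x → Any (λ g → g ⁻¹ ∙ x ∈ L) gs) →
    Syndetic (whole ∖ ⋃ gs (_· B)) → Syndetic (L ∖ B)
  cosyndetic-translates⇒syndetic-∖ L B gs cover =
    syndetic-trans (whole ∖ ⋃ gs (_· B)) (L ∖ B) gs λ {x} (_ , x∉⋃) →
      let g , g∈gs , mem = find (cover x) in
      lose g∈gs (mem , λ ∈B → x∉⋃ (lose g∈gs (∈·⁺ B ∈B)))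

  -- ∇-completeness of the small and of the sparse subsets.

  module _ (inf : Infinite whole) (B : 𝒫) (ΔB-meagre : Meagre (Δ B)) where

    private
      -- After translation by `h ∙ f` this says that `gfB ∩ hfB` is finite for each `f` in `fs`.
      Apart : List Carrier → Rel Carrier _
      Apart fs g h = All (λ f → ¬ (h ∙ f) ⁻¹ ∙ g ∙ f ∈ Δ B) fs

      -- Greedy choice: for given `h` and `f` the unsuitable `g` form a two-sided translate of
      -- `Δ B`, and finitely many meagre sets do not cover the group.
      apart-list : ∀ fs n → ∃ λ gs → length gs ≡ n × AllPairs (Apart fs) gs
      apart-list fs zero    = [] , ≡.refl , []
      apart-list fs (suc n) =
        let gs , len , pairs = apart-list fs n
            A (h , f) = pull ((h ∙ f) ⁻¹) f (Δ B)
            is = cartesianProduct gs fs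
            g , g∉ = meagre⇒∃∉ (⋃ is A) (meagre-⋃ is A λ (h , f) → meagre-pull ((h ∙ f) ⁻¹) f (Δ B) ΔB-meagre)
        in g ∷ gs , cong suc len ,
           All.tabulate (λ h∈gs → All.tabulate λ f∈fs bad → g∉ (lose (∈-cartesianProduct⁺ h∈gs f∈fs) bad))
           ∷ pairs

      -- This is `gfB ∩ hfB`, made empty when that set could be infinite, so that the union over all
      -- triples is finite.
      Coincide : Carrier × Carrier × Carrier → 𝒫
      Coincide (g , h , f) = subset
        (λ x → ¬ (h ∙ f) ⁻¹ ∙ g ∙ f ∈ Δ B × (g ⁻¹ ∙ x ∈ f · B × h ⁻¹ ∙ x ∈ f · B))
        (λ x≈y (k∉ , p , q) → k∉ , resp (f · B) (∙-congˡ x≈y) p , resp (f · B) (∙-congˡ x≈y) q)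

      finite-Coincide : ∀ i → Finite (Coincide i)
      finite-Coincide (g , h , f) with em {P = (h ∙ f) ⁻¹ ∙ g ∙ f ∈ Δ B}
      ... | yes k∈ = finite-∅ (Coincide (g , h , f)) λ (k∉ , _) → k∉ k∈
      ... | no  k∉ = finite-image (Coincide (g , h , f)) (((h ∙ f) ⁻¹ ∙ g ∙ f) · B ∩ B) (h ∙ f)
        (λ {x} (_ , p , q) →
            (f ⁻¹ ∙ (g ⁻¹ ∙ x) , ∈·⁻ B p , sym (begin
              (h ∙ f) ⁻¹ ∙ g ∙ f ∙ (f ⁻¹ ∙ (g ⁻¹ ∙ x))    ≈⟨ assoc _ _ _ ⟩
              (h ∙ f) ⁻¹ ∙ g ∙ (f ∙ (f ⁻¹ ∙ (g ⁻¹ ∙ x)))  ≈⟨ ∙-congˡ (\\-leftDividesˡ f _) ⟩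
              (h ∙ f) ⁻¹ ∙ g ∙ (g ⁻¹ ∙ x)                 ≈⟨ assoc _ _ _ ⟩
              (h ∙ f) ⁻¹ ∙ (g ∙ (g ⁻¹ ∙ x))               ≈⟨ ∙-congˡ (\\-leftDividesˡ g x) ⟩
              (h ∙ f) ⁻¹ ∙ x                              ∎))
          , resp B ([gh]⁻¹x h f x) (∈·⁻ B q))
        (∉Δ⇒finite B k∉)

    Δ-meagre⇒meagre : Meagre B
    Δ-meagre⇒meagre L (fs , cover) =
      cosyndetic-translates⇒syndetic-∖ L B fs cover
        -- A point outside `E` has `g ⁻¹ ∙ x` in `C` for some `g` in `gs`, and the complement of the
        -- finite `E` is syndetic.
        (syndetic-trans (whole ∖ E) C gs
          (λ {x} (_ , x∉E) → Any.map (lift _ ,_) (¬All⇒Any¬ (λ _ → em) gs x∉E))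
          (finite⇒meagre inf E finite-E whole syndetic-whole))
      where
      C : 𝒫
      C = whole ∖ ⋃ fs (_· B)
      -- One more `g` than there are `f`, so that at a point of `E` two of them share an `f`.
      sequence = apart-list fs (suc (length fs))
      gs = proj₁ sequence
      E : 𝒫
      E = subset (λ x → All (λ g → g ⁻¹ ∙ x ∈ ⋃ fs (_· B)) gs)
                 (λ x≈y → All.map (resp (⋃ fs (_· B)) (∙-congˡ x≈y)))
      finite-E : Finite E
      finite-E = finite-⊆ E (⋃ triples Coincide)
        (λ x∈E → let g , h , f , (g∈ , h∈ , f∈) , apart , p , q =
                       allPairs-pigeonhole (proj₂ (proj₂ sequence))
                         (ℕₚ.≤-reflexive (≡.sym (proj₁ (proj₂ sequence)))) x∈E
                 in lose (∈-cartesianProduct⁺ g∈ (∈-cartesianProduct⁺ h∈ f∈)) (All.lookup apart f∈ , p , q))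
        (finite-⋃ triples Coincide finite-Coincide)
        where
        triples = cartesianProduct gs (cartesianProduct gs fs)

  small-∇-complete : Infinite whole → ∇-Complete Small
  small-∇-complete inf A small {B} (ΔB⊆A , A⊆ΔB) = meagre⇒small B (Δ-meagre⇒meagre inf B λ L syn →
    syndetic-⊆ (L ∖ A) (L ∖ Δ B) (λ (l , x∉A) → l , x∉A ∘ ΔB⊆A) (small⇒meagre A small L syn))

  sparse-∇-complete : ∇-Complete Sparse
  sparse-∇-complete A sparse {B} (ΔB⊆A , _) X inf =
    listed xy , finite-listed xy ,
    (λ { (here z≈x) → resp X (sym z≈x) (F⊆X x∈F) ; (there (here z≈y)) → resp X (sym z≈y) y∈X }) ,
    -- Translating `xB ∩ yB` by `x ⁻¹` gives the intersection that defines membership of `x ⁻¹ ∙ y`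
    -- in `Δ B`; that membership would put `y` in `x · A`.
    finite-image (⋂-translates (listed xy) B) ((x ⁻¹ ∙ y) · B ∩ B) x
      (λ {z} z∈⋂ →
          (y ⁻¹ ∙ z , ∈·⁻ B (z∈⋂ y (there (here refl))) , sym (begin
            x ⁻¹ ∙ y ∙ (y ⁻¹ ∙ z)    ≈⟨ assoc _ _ _ ⟩
            x ⁻¹ ∙ (y ∙ (y ⁻¹ ∙ z))  ≈⟨ ∙-congˡ (\\-leftDividesˡ y z) ⟩
            x ⁻¹ ∙ z                 ∎))
        , ∈·⁻ B (z∈⋂ x (here refl)))
      (∉Δ⇒finite B λ ∈ΔB → y∉ (∈·⁺ A (ΔB⊆A ∈ΔB)))
    where
    witness = sparse X inf
    F = proj₁ witness
    F⊆X : F ⊆ X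
    F⊆X = proj₁ (proj₂ (proj₂ witness))
    -- Otherwise the infinite `X` would lie in the finite intersection of the translates of `A` by
    -- `F`.
    escape : ∃ λ y → y ∈ X × ∃ λ x → x ∈ F × ¬ y ∈ x · A
    escape = ¬¬-elim λ none → inf (finite-⊆ X (⋂-translates F A)
      (λ {y} y∈X x x∈F → ¬¬-elim λ y∉ → none (y , y∈X , x , x∈F , y∉))
      (proj₂ (proj₂ (proj₂ witness))))
    y = proj₁ escape
    y∈X = proj₁ (proj₂ escape)
    x = proj₁ (proj₂ (proj₂ escape))
    x∈F = proj₁ (proj₂ (proj₂ (proj₂ escape)))
    y∉ : ¬ y ∈ x · A
    y∉ = proj₂ (proj₂ (proj₂ (proj₂ escape)))
    xy = x ∷ y ∷ []

  -- Group ideals.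

  Δ⊆AA⁻¹ : ∀ A → Δ A ⊆ A ⊙ A ⁻¹ˢ
  Δ⊆AA⁻¹ A {g} inf =
    let x , (a , a∈A , x≈ga) , x∈A = infinite⇒satisfiable (g · A ∩ A) inf in
    x , a ⁻¹ , x∈A , (a , a∈A , refl) ,
    sym (trans (∙-congʳ x≈ga) (//-rightDividesʳ a g))

  module _ {i} {𝓘 : Family i} (groupIdeal : IsGroupIdeal 𝓘) where

    open IsGroupIdeal groupIdeal
    open IsIdeal isIdeal

    groupIdeal-Δ-complete : Δ-Complete 𝓘
    groupIdeal-Δ-complete A A∈𝓘 = ⊆-closed (Δ A) (A ⊙ A ⁻¹ˢ) (Δ⊆AA⁻¹ A) (⊙⁻¹-closed A A A∈𝓘 A∈𝓘)

    -- Closure under `A ⊙ B ⁻¹ˢ` is applied with `{ε}` on the left; a second inversion then gives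
    -- `translates-closed`.
    ⁻¹-closed : ∀ A → 𝓘 A → 𝓘 (A ⁻¹ˢ)
    ⁻¹-closed A A∈𝓘 = ⊆-closed (A ⁻¹ˢ) (listed (ε ∷ []) ⊙ A ⁻¹ˢ)
      (λ {x} x∈ → ε , x , here refl , x∈ , sym (identityˡ x))
      (⊙⁻¹-closed (listed (ε ∷ [])) A (finite (listed (ε ∷ [])) (finite-listed (ε ∷ []))) A∈𝓘)

    translates-closed : ∀ gs A → 𝓘 A → 𝓘 (⋃ gs (_· A))
    translates-closed gs A A∈𝓘 = ⊆-closed (⋃ gs (_· A)) (listed gs ⊙ (A ⁻¹ˢ) ⁻¹ˢ)
      (λ x∈ → let g , g∈gs , a , a∈A , x≈ga = find x∈ in
        g , a , Any.map reflexive g∈gs , (a ⁻¹ , (a , a∈A , refl) , sym (⁻¹-involutive a)) , x≈ga)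
      (⊙⁻¹-closed (listed gs) (A ⁻¹ˢ) (finite (listed gs) (finite-listed gs)) (⁻¹-closed A A∈𝓘))

    -- Since `𝓘` is proper, some `g` is outside `A ⊙ A ⁻¹ˢ`. If `x` and `g ⁻¹ ∙ x` were both in `A`,
    -- their quotient `g` would be in that product.
    ∁-syndetic : ∀ A → 𝓘 A → Syndetic (whole ∖ A)
    ∁-syndetic A A∈𝓘 = ε ∷ g ∷ [] , cover
      where
      outside : ∃ λ g → ¬ g ∈ A ⊙ A ⁻¹ˢ
      outside = ¬¬-elim λ none → proper (⊆-closed whole (A ⊙ A ⁻¹ˢ)
        (λ {x} _ → ¬¬-elim λ x∉ → none (x , x∉)) (⊙⁻¹-closed A A A∈𝓘 A∈𝓘))
      g = proj₁ outside
      cover : ∀ x → Any (λ h → h ⁻¹ ∙ x ∈ (whole ∖ A)) (ε ∷ g ∷ [])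
      cover x with em {P = x ∈ A}
      ... | no x∉A = here (lift _ , λ ∈A → x∉A (resp A (trans (∙-congʳ ε⁻¹≈ε) (identityˡ x)) ∈A))
      ... | yes x∈A = there (here (lift _ , λ ∈A → proj₂ outside
        (x , (g ⁻¹ ∙ x) ⁻¹ , x∈A , (g ⁻¹ ∙ x , ∈A , refl) ,
          sym (trans (∙-congʳ (sym (\\-leftDividesˡ g x))) (//-rightDividesʳ (g ⁻¹ ∙ x) g)))))

    groupIdeal-small : ∀ A → 𝓘 A → Small A
    groupIdeal-small A A∈𝓘 = meagre⇒small A λ L (gs , cover) →
      cosyndetic-translates⇒syndetic-∖ L A gs cover (∁-syndetic (⋃ gs (_· A)) (translates-closed gs A A∈𝓘))

-- Choice by well-founded recursion.

module _ (em : ∀ {a} → ExcludedMiddle a) (ext : ∀ {a b} → Extensionality a b)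
         {a c p r} {J : Set a} {_≺_ : Rel J r} (wf : WellFounded _≺_) {C : Set c} (default : C)
         (P : ∀ j → WfRec _≺_ (λ _ → C) j → C → Set p) where

  private
    pick : ∀ j (prior : WfRec _≺_ (λ _ → C) j) → Dec (∃ (P j prior)) → C
    pick j prior (yes (x , _)) = x
    pick j prior (no _)        = default

    pick-correct : ∀ j (prior : WfRec _≺_ (λ _ → C) j) d → ∃ (P j prior) → P j prior (pick j prior d)
    pick-correct j prior (yes (_ , px)) _  = px
    pick-correct j prior (no none)      ex = contradiction ex none

    choose : ∀ j → WfRec _≺_ (λ _ → C) j → C
    choose j prior = pick j prior em

    choose-ext : ∀ j {prior prior′ : WfRec _≺_ (λ _ → C) j} →
                 (∀ {i} (i≺j : i ≺ j) → prior i≺j ≡ prior′ i≺j) → choose j prior ≡ choose j prior′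
    choose-ext j eq = cong (λ (prior : WfRec _≺_ (λ _ → C) j) → choose j prior)
      (implicit-extensionality ext (ext eq))

    open WF.All wf c using (wfRec)
    open FixPoint wf (λ _ → C) choose choose-ext using (unfold-wfRec)

  abstract
    -- Where no candidate exists the recursion takes `default`. Existence is thus asked for only
    -- once `X` is defined, and its proof may speak of `X`.
    recursive-choice : ∃ λ (X : J → C) →
      ∀ j → ∃ (P j (λ {i} _ → X i)) → P j (λ {i} _ → X i) (X j)
    recursive-choice = wfRec (λ _ → C) choose , λ j ex →
      subst (P j _) (≡.sym unfold-wfRec) (pick-correct j _ em ex)

-- Generic families and their Δ.

module Generation (em : ∀ {a} → ExcludedMiddle a) (ext : ∀ {a b} → Extensionality a b)
                  {c ℓ} (G : Group c ℓ) where

  open Group G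
  open Subsets em G
  open import Relation.Binary.Reasoning.Setoid setoid
  open Membership setoid using () renaming (_∈_ to _∈ᴸ_)
  open SubsetsOf G

  -- Indices may carry proofs, and two that differ only there need not be comparable; hence `connex`
  -- asks for different values.
  record Generic : Set (lsuc c ⊔ ℓ) where
    infix 4 _≺_
    field
      I       : Set c
      Z       : I → Carrier
      _≺_     : Rel I c
      ≺-trans : Transitive _≺_
      connex  : ∀ i j → ¬ Z i ≈ Z j → i ≺ j ⊎ j ≺ i
      generic : ∀ {i k l j} → i ≺ j → k ≺ j → l ≺ j → ¬ Z j ≈ Z l ∙ Z k ⁻¹ ∙ Z i

    range : 𝒫
    range = subset (λ x → ∃ λ i → Z i ≈ x) (λ x≈y (i , Zi≈x) → i , trans Zi≈x x≈y)

    ≺⇒≉ : ∀ {i j} → i ≺ j → ¬ Z j ≈ Z i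
    ≺⇒≉ {i} i≺j Zj≈Zi = generic i≺j i≺j i≺j (trans Zj≈Zi (sym (//-rightDividesˡ (Z i) (Z i))))

    SameQuotient : (i j k l : I) → Set ℓ
    SameQuotient i j k l = Z j ∙ Z i ⁻¹ ≈ Z l ∙ Z k ⁻¹

    private
      invert : ∀ {i j k l} → SameQuotient i j k l → SameQuotient j i l k
      invert {i} {j} {k} {l} eq = trans (sym (flip i j)) (trans (⁻¹-cong eq) (flip k l))
        where
        flip : ∀ i j → (Z j ∙ Z i ⁻¹) ⁻¹ ≈ Z i ∙ Z j ⁻¹
        flip i j = trans (⁻¹-anti-homo-∙ (Z j) (Z i ⁻¹)) (∙-congʳ (⁻¹-involutive (Z i)))

      -- Solving the equation for `Z j` makes it a product of earlier values. The cases with another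
      -- index on top reduce to this one by `sym` and `invert`.
      no-top : ∀ {i j k l} → SameQuotient i j k l → i ≺ j → k ≺ j → ¬ l ≺ j
      no-top {i} {j} {k} {l} eq i≺j k≺j l≺j = generic i≺j k≺j l≺j (begin
        Z j                     ≈⟨ //-rightDividesˡ (Z i) (Z j) ⟨
        Z j ∙ Z i ⁻¹ ∙ Z i      ≈⟨ ∙-congʳ eq ⟩
        Z l ∙ Z k ⁻¹ ∙ Z i      ∎)

      no-top₂ : ∀ {i j k l} → SameQuotient i j k l → ¬ Z j ≈ Z l → i ≺ j → ¬ k ≺ l
      no-top₂ {i} {j} {k} {l} eq j≉l i≺j k≺l with connex j l j≉l
      ... | inj₁ j≺l = no-top {k} {l} {i} {j} (sym eq) k≺l (≺-trans i≺j j≺l) j≺l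
      ... | inj₂ l≺j = no-top {i} {j} {k} {l} eq i≺j (≺-trans k≺l l≺j) l≺j

      no-top₂′ : ∀ {i j k l} → SameQuotient i j k l → ¬ Z j ≈ Z k → i ≺ j → ¬ l ≺ k
      no-top₂′ {i} {j} {k} {l} eq j≉k i≺j l≺k with connex j k j≉k
      ... | inj₁ j≺k = no-top {l} {k} {j} {i} (sym (invert {i} {j} {k} {l} eq)) l≺k j≺k (≺-trans i≺j j≺k)
      ... | inj₂ k≺j = no-top {i} {j} {k} {l} eq i≺j k≺j (≺-trans l≺k k≺j)

    -- The largest of four distinct indices would be a product of the other three.
    quotients-distinct : ∀ {i j k l} → SameQuotient i j k l →
      ¬ Z i ≈ Z j → ¬ Z k ≈ Z l → ¬ Z j ≈ Z l → ¬ Z j ≈ Z k → ¬ Z i ≈ Z k → Z i ≈ Z l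
    quotients-distinct {i} {j} {k} {l} eq i≉j k≉l j≉l j≉k i≉k = ¬¬-elim λ i≉l →
      absurd i≉l (connex i j i≉j) (connex k l k≉l)
      where
      absurd : ¬ Z i ≈ Z l → i ≺ j ⊎ j ≺ i → ¬ (k ≺ l ⊎ l ≺ k)
      absurd i≉l (inj₁ i≺j) (inj₁ k≺l) = no-top₂  {i} {j} {k} {l} eq j≉l i≺j k≺l
      absurd i≉l (inj₁ i≺j) (inj₂ l≺k) = no-top₂′ {i} {j} {k} {l} eq j≉k i≺j l≺k
      absurd i≉l (inj₂ j≺i) (inj₁ k≺l) = no-top₂′ {j} {i} {l} {k} (invert {i} {j} {k} {l} eq) i≉l j≺i k≺l
      absurd i≉l (inj₂ j≺i) (inj₂ l≺k) = no-top₂  {j} {i} {l} {k} (invert {i} {j} {k} {l} eq) i≉k j≺i l≺k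

    -- For `h` other than `ε`, fix one solution of `Z j = h ∙ Z i`. Any other solution has the same
    -- quotient, so it shares a value with the first, which leaves three candidates for `z`.
    Δ-range : Δ range ⊆ listed (ε ∷ [])
    Δ-range {h} inf = ¬¬-elim λ h∉ε → let h≉ε = h∉ε ∘ here in
      let z₀ , (a , (i , Zi≈a) , z₀≈ha) , (j , Zj≈z₀) = infinite⇒satisfiable (h · range ∩ range) inf
          Zj≈hZi : Z j ≈ h ∙ Z i
          Zj≈hZi = trans Zj≈z₀ (trans z₀≈ha (∙-congˡ (sym Zi≈a)))
      in inf (subfinite⇒finite (h · range ∩ range) (Z j ∷ h ∙ Z j ∷ Z i ∷ [])
        λ {z} ((b , (k , Zk≈b) , z≈hb) , (l , Zl≈z)) → ¬¬-elim λ z∉ →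
          let z≈hZk : z ≈ h ∙ Z k
              z≈hZk = trans z≈hb (∙-congˡ (sym Zk≈b))
              quot : ∀ {x y} → y ≈ h ∙ x → y ∙ x ⁻¹ ≈ h
              quot {x} y≈hx = trans (∙-congʳ y≈hx) (//-rightDividesʳ x h)
              moves : ∀ {x y} → y ≈ h ∙ x → ¬ x ≈ y
              moves {x} {y} y≈hx x≈y = h≉ε (identityˡ-unique h x (trans (sym y≈hx) (sym x≈y)))
              Zl≈hZk = trans Zl≈z z≈hZk
          in z∉ (there (there (here (trans (sym Zl≈z) (sym (quotients-distinct {i} {j} {k} {l}
               (trans (quot Zj≈hZi) (sym (quot Zl≈hZk)))
               (moves Zj≈hZi) (moves Zl≈hZk)
               (λ j≈l → z∉ (here (trans (sym Zl≈z) (sym j≈l))))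
               (λ j≈k → z∉ (there (here (trans z≈hZk (∙-congˡ (sym j≈k))))))
               (λ i≈k → z∉ (here (trans z≈hZk (trans (∙-congˡ (sym i≈k)) (sym Zj≈hZi))))))))))))

  -- A minimal generating initial segment.

  private
    order = WellOrdering.wellOrder em ext Carrier

  infix 4 _<_ _≤_
  _<_ : Rel Carrier 0ℓ
  _<_ = proj₁ order

  <-isSTO : IsStrictTotalOrder _≡_ _<_
  <-isSTO = proj₁ (proj₂ order)

  <-wf : WellFounded _<_
  <-wf = proj₂ (proj₂ order)

  private
    module < = IsStrictTotalOrder <-isSTO

  _≤_ : Rel Carrier c
  x ≤ y = x < y ⊎ x ≡ y

  ≤-<-trans : ∀ {x y z} → x ≤ y → y < z → x < z
  ≤-<-trans (inj₁ x<y)    y<z = <.trans x<y y<z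
  ≤-<-trans (inj₂ ≡.refl) y<z = y<z

  ≤-trans : ∀ {x y z} → x ≤ y → y ≤ z → x ≤ z
  ≤-trans x≤y (inj₁ y<z)    = inj₁ (≤-<-trans x≤y y<z)
  ≤-trans x≤y (inj₂ ≡.refl) = x≤y

  ≮⇒≥ : ∀ {x y} → ¬ x < y → y ≤ x
  ≮⇒≥ {x} {y} x≮y with <.compare x y
  ... | tri< x<y _ _   = contradiction x<y x≮y
  ... | tri≈ _ x≡y _   = inj₂ (≡.sym x≡y)
  ... | tri> _ _ y<x   = inj₁ y<x

  Operation : Set c
  Operation = ∃ λ k → Vec Carrier k → Carrier

  image : ∀ {p} → Pred Carrier p → Operation → Pred Carrier (c ⊔ ℓ ⊔ p)
  image U (k , f) x = ∃ λ v → Allⱽ U v × f v ≈ x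

  -- A substitute for |U| = |G| that visibly survives removing one element from
  -- U and composing operations, so that no cardinal arithmetic is needed.
  Generates : ∀ {p} → Pred Carrier p → Set (c ⊔ ℓ ⊔ p)
  Generates U = ∃ λ fs → ∀ x → Any (λ f → image U f x) fs

  module _ (q : Carrier) where

    Substitution : ℕ → Set c
    Substitution k = ∃ λ k′ → Vec Carrier k′ → Vec Carrier k

    Attains : ∀ {k} → Vec Carrier k → Substitution k → Set c
    Attains v (k′ , φ) = ∃ λ v′ → Allⱽ (_< q) v′ × φ v′ ≡ v

    insert : ∀ {k} → Substitution k → List (Substitution (suc k))
    insert (k′ , φ) = (k′ , λ v → q ∷ φ v) ∷ (suc k′ , λ v → Vec.head v ∷ φ (Vec.tail v)) ∷ []

    -- One substitution for each choice of the places that hold `q`; the remaining places are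
    -- variables.
    substitutions : ∀ k → List (Substitution k)
    substitutions zero    = (0 , id) ∷ []
    substitutions (suc k) = concatMap insert (substitutions k)

    substitutions-complete : ∀ {k} {v : Vec Carrier k} → Allⱽ (_≤ q) v → Any (Attains v) (substitutions k)
    substitutions-complete []          = here ([] , [] , ≡.refl)
    substitutions-complete {v = x ∷ v} (x≤q ∷ v≤q) =
      Anyₚ.concatMap⁺ insert (Any.map (λ {s} → step {s = s} x≤q) (substitutions-complete v≤q))
      where
      step : ∀ {s} → x ≤ q → Attains v s → Any (Attains (x ∷ v)) (insert s)
      step (inj₂ ≡.refl) (v′ , v′<q , ≡.refl) = here (v′ , v′<q , ≡.refl)
      step (inj₁ x<q)    (v′ , v′<q , ≡.refl) = there (here (x ∷ v′ , x<q ∷ v′<q , ≡.refl))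

    -- The element `q` becomes a constant: each operation is replaced by its finitely many
    -- composites with `substitutions`.
    generates-≤⇒generates-< : Generates (_≤ q) → Generates (_< q)
    generates-≤⇒generates-< (fs , gen) =
      concatMap expand fs , λ x → Anyₚ.concatMap⁺ expand (Any.map
        (λ {(k , f)} (v , v≤q , fv≈x) → Anyₚ.map⁺ (Any.map
          (λ (v′ , v′<q , φv′≡v) → v′ , v′<q , trans (reflexive (cong f φv′≡v)) fv≈x)
          (substitutions-complete v≤q))) (gen x))
      where
      expand : Operation → List Operation
      expand (k , f) = map (λ (k′ , φ) → k′ , f ∘ φ) (substitutions k)

  record MinimalGenerating : Set (lsuc c ⊔ ℓ) where
    field
      U         : Pred Carrier c
      generates : Generates U
      minimal   : ∀ {q} → U q → ¬ Generates (_< q)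

  minimalGenerating : MinimalGenerating
  minimalGenerating with em {P = ∃ λ q → Generates (_< q)}
  -- No segment below an element generates, so `U` is everything, generated by the unary identity.
  ... | no none = record
    { U = λ _ → Lift c ⊤
    ; generates = ((1 , Vec.head) ∷ []) , λ x → here (x ∷ [] , lift tt ∷ [] , refl)
    ; minimal = λ {q} _ gen → none (q , gen)
    }
  ... | yes (q , gen) = descend (<-wf q) gen
    where
    descend : ∀ {q} → Acc _<_ q → Generates (_< q) → MinimalGenerating
    descend {q} (acc rs) gen with em {P = ∃ λ q′ → q′ < q × Generates (_< q′)}
    ... | yes (q′ , q′<q , gen′) = descend (rs q′<q) gen′
    ... | no none = record
      { U = λ x → Lift c (x < q)
      ; generates = proj₁ gen , λ x → Any.map (λ (v , v<q , eq) → v , Allⱽ.map lift v<q , eq) (proj₂ gen x)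
      ; minimal = λ {q′} (lift q′<q) gen′ → none (q′ , q′<q , gen′)
      }

  ++-take : ∀ {k m} (v : Vec Carrier k) (w : Vec Carrier m) → Vec.take k (v Vec.++ w) ≡ v
  ++-take {k} v w = Vecₚ.++-injectiveˡ _ v (Vecₚ.take++drop≡id k (v Vec.++ w))

  ++-drop : ∀ {k m} (v : Vec Carrier k) (w : Vec Carrier m) → Vec.drop k (v Vec.++ w) ≡ w
  ++-drop {k} v w = Vecₚ.++-injectiveʳ (Vec.take k (v Vec.++ w)) v (Vecₚ.take++drop≡id k (v Vec.++ w))

  -- An operation takes a single vector, so the three arguments are concatenated.
  ternary : ∀ {k} → (Vec Carrier k → Vec Carrier k → Vec Carrier k → Carrier) → Operation
  ternary {k} f = k ℕ.+ (k ℕ.+ k) , λ v →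
    f (Vec.take k v) (Vec.take k (Vec.drop k v)) (Vec.drop k (Vec.drop k v))

  ternary-image : ∀ {p} {U : Pred Carrier p} {k} f {u v w : Vec Carrier k} {x} →
    Allⱽ U u → Allⱽ U v → Allⱽ U w → f u v w ≈ x → image U (ternary f) x
  ternary-image f {u} {v} {w} Uu Uv Uw eq =
    u Vec.++ (v Vec.++ w) , Allⱽₚ.++⁺ Uu (Allⱽₚ.++⁺ Uv Uw) ,
    trans (reflexive restore) eq
    where
    restore : proj₂ (ternary f) (u Vec.++ (v Vec.++ w)) ≡ f u v w
    restore rewrite ++-take u (v Vec.++ w) | ++-drop u (v Vec.++ w) | ++-take v w | ++-drop v w = ≡.refl

  -- Two generic families, and families that are both Δ- and ∇-complete.

  module _ (inf : Infinite whole) where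

    open MinimalGenerating minimalGenerating

    -- Over an empty `U` only nullary operations have values, one each, and the group would be
    -- finite.
    U-nonempty : ∃ λ q → U q
    U-nonempty = ¬¬-elim λ empty → inf (finite-⊆ whole (⋃ (proj₁ generates) constants)
      (λ {x} _ → Any.map (λ {f} → into empty f) (proj₂ generates x))
      (finite-⋃ (proj₁ generates) constants λ { (zero , f) → finite-listed _ ; (suc k , f) → finite-listed _ }))
      where
      constants : Operation → 𝒫
      constants (zero  , f) = listed (f [] ∷ [])
      constants (suc k , f) = listed []
      into : ¬ (∃ λ q → U q) → ∀ f {x} → image U f x → x ∈ constants f
      into empty (zero  , f) ([] , _ , eq)         = here (sym eq)
      into empty (suc k , f) (q ∷ _ , Uq ∷ _ , _)  = contradiction (q , Uq) empty

    -- If `q` were the largest element of `U`, the elements `≤ q` would generate, hence also those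
    -- `< q`, against minimality.
    U-unbounded : ∀ {q} → U q → ∃ λ q′ → U q′ × q < q′
    U-unbounded {q} Uq = ¬¬-elim λ top → minimal Uq (generates-≤⇒generates-< q
      (proj₁ generates , λ x → Any.map
        (λ (v , Uv , eq) → v , Allⱽ.map (λ {q′} Uq′ → ≮⇒≥ λ q<q′ → top (q′ , Uq′ , q<q′)) Uv , eq)
        (proj₂ generates x)))

    U-bound : ∀ {k} {v : Vec Carrier k} → Allⱽ U v → ∃ λ q → U q × Allⱽ (_≤ q) v
    U-bound []        = let q , Uq = U-nonempty in q , Uq , []
    U-bound {v = x ∷ _} (Ux ∷ Uv) with U-bound Uv
    ... | q , Uq , v≤q with em {P = x < q}
    ...   | yes x<q = q , Uq , inj₁ x<q ∷ v≤q
    ...   | no  x≮q = x , Ux , inj₂ ≡.refl ∷ Allⱽ.map (λ y≤q → ≤-trans y≤q (≮⇒≥ x≮q)) v≤q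

    module _ {k} (f : Vec Carrier k → Carrier) where

      private
        -- The tail `v` names the group element `f v`. The head is a counter in `U` that lets each
        -- such element recur at unboundedly many indices.
        Index : Set c
        Index = Vec Carrier (suc k)

        infix 4 _≺_
        _≺_ : Rel Index c
        _≺_ = Lex.Lex-< _≡_ _<_

        ≺-wf : WellFounded _≺_
        ≺-wf = Lex.<-wellFounded ≡.trans (λ { ≡.refl → id }) <-wf

        module ≺ = IsStrictTotalOrder (Lex.<-isStrictTotalOrder <-isSTO {suc k})

        -- The head of an index bounds its tail, so that the indices below a
        -- given one are vectors over an initial segment.
        Valid : Index → Set c
        Valid (q ∷ v) = U q × Allⱽ (_≤ q) v

        ≺⇒≤ : ∀ {i} q v → i ≺ q ∷ v → Valid i → Allⱽ (_≤ q) i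
        ≺⇒≤ {x ∷ w} q v i≺j (_ , w≤x) = x≤q i≺j ∷ Allⱽ.map (λ y≤x → ≤-trans y≤x (x≤q i≺j)) w≤x
          where
          x≤q : x ∷ w ≺ q ∷ v → x ≤ q
          x≤q (Lex.this x<q _) = inj₁ x<q
          x≤q (Lex.next x≡q _) = inj₂ x≡q

        γ : Index → Carrier
        γ (q ∷ v) = f v

        Combination : (Index → Carrier) → Index → Index → Index → Carrier
        Combination Z a b d = Z a ∙ Z b ⁻¹ ∙ Z d

        -- The two conditions make `X` and `Y` generic. Earlier indices that are not valid are left
        -- out, as their entries need not be bounded by the head of `j`.
        Fresh : ∀ j → WfRec _≺_ (λ _ → Carrier) j → Carrier → Set (c ⊔ ℓ)
        Fresh j prior x = ∀ a b d (a≺j : a ≺ j) (b≺j : b ≺ j) (d≺j : d ≺ j) → Valid a → Valid b → Valid d →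
          ¬ x ≈ prior a≺j ∙ prior b≺j ⁻¹ ∙ prior d≺j ×
          ¬ γ j ∙ x ≈ γ a ∙ prior a≺j ∙ (γ b ∙ prior b≺j) ⁻¹ ∙ (γ d ∙ prior d≺j)

        chosen : ∃ λ (X : Index → Carrier) →
          ∀ j → ∃ (Fresh j (λ {i} _ → X i)) → Fresh j (λ {i} _ → X i) (X j)
        chosen = recursive-choice em ext ≺-wf ε Fresh

        X Y : Index → Carrier
        X = proj₁ chosen
        Y j = γ j ∙ X j

        -- Otherwise the initial segment below the head of j would generate G.
        fresh-exists : ∀ j → Valid j → ∃ (Fresh j (λ {i} _ → X i))
        fresh-exists j@(q ∷ v) (Uq , _) = ¬¬-elim λ none →
          -- An earlier index may share the head `q`, so its entries are only `≤ q`. The two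
          -- operations list the two ways in which `x` can fail to be fresh.
          minimal Uq (generates-≤⇒generates-< q
            ( ternary (Combination X) ∷ ternary (λ a b d → f v ⁻¹ ∙ Combination Y a b d) ∷ []
            , λ x → ¬¬-elim λ ¬gen → none (x , λ a b d a≺j b≺j d≺j Va Vb Vd →
                (λ x≈ → ¬gen (here (ternary-image (Combination X)
                  (≺⇒≤ q v a≺j Va) (≺⇒≤ q v b≺j Vb) (≺⇒≤ q v d≺j Vd) (sym x≈)))) ,
                (λ γx≈ → ¬gen (there (here (ternary-image (λ a b d → f v ⁻¹ ∙ Combination Y a b d)
                  (≺⇒≤ q v a≺j Va) (≺⇒≤ q v b≺j Vb) (≺⇒≤ q v d≺j Vd)
                  (trans (∙-congˡ (sym γx≈)) (\\-leftDividesʳ (f v) x)))))))))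

        fresh : ∀ j → Valid j → Fresh j (λ {i} _ → X i) (X j)
        fresh j Vj = proj₂ chosen j (fresh-exists j Vj)

        genericFamily : (Z : Index → Carrier) →
          (∀ {i k l j} → i ≺ j → k ≺ j → l ≺ j → Valid i → Valid k → Valid l → Valid j →
            ¬ Z j ≈ Combination Z l k i) → Generic
        genericFamily Z gen = record
          { I       = ∃ Valid
          ; Z       = Z ∘ proj₁
          ; _≺_     = λ (i , _) (j , _) → i ≺ j
          ; ≺-trans = ≺.trans
          ; connex  = λ (i , _) (j , _) i≉j → connex i j i≉j (≺.compare i j)
          ; generic = λ {(i , Vi)} {(k , Vk)} {(l , Vl)} {(j , Vj)} i≺j k≺j l≺j → gen i≺j k≺j l≺j Vi Vk Vl Vj
          }
          where
          connex : ∀ i j → ¬ Z i ≈ Z j → _ → i ≺ j ⊎ j ≺ i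
          connex i j i≉j (tri< i≺j _ _) = inj₁ i≺j
          connex i j i≉j (tri≈ _ i≋j _) = contradiction (reflexive (cong Z (Pointwise-≡⇒≡ i≋j))) i≉j
          connex i j i≉j (tri> _ _ j≺i) = inj₂ j≺i

      X-family Y-family : Generic
      X-family = genericFamily X λ i≺j k≺j l≺j Vi Vk Vl Vj → proj₁ (fresh _ Vj _ _ _ l≺j k≺j i≺j Vl Vk Vi)
      Y-family = genericFamily Y λ i≺j k≺j l≺j Vi Vk Vl Vj → proj₂ (fresh _ Vj _ _ _ l≺j k≺j i≺j Vl Vk Vi)

      X∪Y : 𝒫
      X∪Y = Generic.range X-family ∪ Generic.range Y-family

      -- By `≺⇒≉` the values `Y (r ∷ v)` at valid indices differ for different `r`, so each listed
      -- `y` occurs at most once and the bound can be moved past it.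
      Y-eventually-∉ : ∀ {v} → ∀ {q} → U q → Allⱽ (_≤ q) v → ∀ ys →
        ∃ λ q′ → U q′ × Allⱽ (_≤ q′) v × (∀ {r} → U r → q′ < r → ¬ Y (r ∷ v) ∈ᴸ ys)
      Y-eventually-∉ Uq v≤q [] = _ , Uq , v≤q , λ _ _ ()
      Y-eventually-∉ {v} Uq v≤q (y ∷ ys) with Y-eventually-∉ Uq v≤q ys
      ... | q , Uq , v≤q , avoids with em {P = ∃ λ r → U r × q < r × Y (r ∷ v) ≈ y}
      ...   | no none = q , Uq , v≤q , λ Ur q<r →
        λ { (here Y≈y) → none (_ , Ur , q<r , Y≈y) ; (there Y∈ys) → avoids Ur q<r Y∈ys }
      ...   | yes (r , Ur , q<r , Yr≈y) = r , Ur , v≤ q<r , λ Us r<s →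
        λ { (here Ys≈y)  → Generic.≺⇒≉ Y-family {_ , Ur , v≤ q<r} {_ , Us , v≤ (<.trans q<r r<s)}
                             (Lex.this r<s ≡.refl) (trans Ys≈y (sym Yr≈y))
          ; (there Y∈ys) → avoids Us (<.trans q<r r<s) Y∈ys }
        where
        v≤ : ∀ {s} → q < s → Allⱽ (_≤ s) v
        v≤ q<s = Allⱽ.map (λ x≤q → ≤-trans x≤q (inj₁ q<s)) v≤q

      -- If `g ≈ f v`, the points `Y (r ∷ v) ≈ g ∙ X (r ∷ v)` lie in `X∪Y` and in its translate by
      -- `g`, and no finite list holds them all.
      image⊆Δ : ∀ {g} → image U (k , f) g → g ∈ Δ X∪Y
      image⊆Δ {g} (v , Uv , fv≈g) (ys , ⊆ys , _) =
        let q₀ , Uq₀ , v≤q₀ = U-bound Uv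
            q , Uq , v≤q , avoids = Y-eventually-∉ Uq₀ v≤q₀ ys
            r , Ur , q<r = U-unbounded Uq
            j = (r ∷ v) , Ur , Allⱽ.map (λ x≤q → ≤-trans x≤q (inj₁ q<r)) v≤q
        in avoids Ur q<r (⊆ys ((X (r ∷ v) , inj₁ (j , refl) , ∙-congʳ fv≈g) , inj₂ (j , refl)))

    module _ {i} {𝓘 : Family i} (nonempty : Satisfiable 𝓘) (∪-closed : ClosedUnder∪ 𝓘) (⊆-closed : ClosedUnder⊆ 𝓘)
             (Δ-complete : Δ-Complete 𝓘) (∇-complete : ∇-Complete 𝓘) where

      private
        Δ∈⇒∈ : ∀ A → 𝓘 (Δ A) → 𝓘 A
        Δ∈⇒∈ A ΔA∈𝓘 = ∇-complete (Δ A) ΔA∈𝓘 (id , id)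

        -- `Δ` of a finite set is empty, so it lies below any given member of `𝓘`.
        finite∈ : ∀ A → Finite A → 𝓘 A
        finite∈ A fin = Δ∈⇒∈ A (⊆-closed (Δ A) (proj₁ nonempty)
          (λ {g} inf-gA∩A → contradiction (finite-⊆ (g · A ∩ A) A proj₂ fin) inf-gA∩A) (proj₂ nonempty))

        range∈ : ∀ F → 𝓘 (Generic.range F)
        range∈ F = Δ∈⇒∈ (Generic.range F) (⊆-closed (Δ (Generic.range F)) (listed (ε ∷ []))
          (Generic.Δ-range F) (finite∈ (listed (ε ∷ [])) (finite-listed (ε ∷ []))))

        ⋃∈ : ∀ {J : Set c} (is : List J) A → (∀ i → 𝓘 (A i)) → 𝓘 (⋃ is A)
        ⋃∈ []       A A∈𝓘 = finite∈ (⋃ [] A) (finite-∅ (⋃ [] A) λ ())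
        ⋃∈ (i ∷ is) A A∈𝓘 = ⊆-closed (⋃ (i ∷ is) A) (A i ∪ ⋃ is A) Any.toSum
          (∪-closed (A i) (⋃ is A) (A∈𝓘 i) (⋃∈ is A A∈𝓘))

        cover : Operation → 𝒫
        cover (k , f) = Δ (X∪Y f)

      -- The images of `U` under finitely many operations cover the group, and each lies in some
      -- `Δ (X∪Y f)`, a member of `𝓘`.
      everything∈ : ∀ A → 𝓘 A
      everything∈ A = ⊆-closed A (⋃ (proj₁ generates) cover)
        (λ {x} _ → Any.map (λ {(k , f)} → image⊆Δ f) (proj₂ generates x))
        (⋃∈ (proj₁ generates) cover λ (k , f) → Δ-complete (X∪Y f)
          (∪-closed (Generic.range (X-family f)) (Generic.range (Y-family f))
            (range∈ (X-family f)) (range∈ (Y-family f))))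

theorem7p4 : (∀ {a} → ExcludedMiddle a) →
    (∀ {a b} → Extensionality a b) →
    ∀ {c ℓ i : Level} (G : Group c ℓ) →
    let open SubsetsOf G in
    Infinite whole →
    (∇-Complete Small × ∇-Complete Sparse)
    × ((∀ (𝓘 : Family i) → Satisfiable 𝓘 → ClosedUnder∪ 𝓘 → ClosedUnder⊆ 𝓘 →
    Δ-Complete 𝓘 → ∇-Complete 𝓘 → ∀ A → 𝓘 A)
    × (∀ (𝓘 : Family i) → IsIdeal 𝓘 → ¬ (Δ-Complete 𝓘 × ∇-Complete 𝓘)))
    × (∀ (𝓘 : Family i) → IsGroupIdeal 𝓘 →
    Δ-Complete 𝓘 × (∀ A → 𝓘 A → Small A))
theorem7p4 em ext G inf =
  (small-∇-complete inf , sparse-∇-complete) ,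
  ( (λ 𝓘 → everything∈ inf)
  , λ 𝓘 ideal (Δ-complete , ∇-complete) → let open IsIdeal ideal in
      proper (everything∈ inf nonempty ∪-closed ⊆-closed Δ-complete ∇-complete whole)) ,
  λ 𝓘 groupIdeal → groupIdeal-Δ-complete groupIdeal , groupIdeal-small groupIdeal
  where
  open SubsetsOf G
  open Subsets em G
  open Generation em ext G
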